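{- Let $A$ be an inhabited set with decidable equality, and let $\iota\colon A^{\mathbb N}\hookrightarrow\mathcal A$ be the injection $\iota(\alpha)=\{\tau\in A^*\mid\tau\prec\alpha\}$ from infinite sequences on $A$ to the ideal completion $\mathcal A$ of the poset of finite sequences on $A$ ordered by prefix. The image of $\iota$ is exactly the subset of strongly maximal elements of $\mathcal A$.
   Context: Everything is constructive: neither excluded middle nor choice is assumed. Decidable equality: for all $a,b\in A$, $a=b$ or $a\neq b$. A subset $S$ of a poset is directed if it is inhabited and any two elements of $S$ have an upper bound in $S$. A dcpo is a poset $(D,\sqsubseteq)$ in which every directed subset $S$ has a supremum $\bigsqcup S$. Write $x\ll y$ if for every directed $S$ with $y\sqsubseteq\bigsqcup S$ there is $s\in S$ with $x\sqsubseteq s$. $D$ is continuous if for every $x$ the set $\{y\in D\mid y\ll x\}$ is directed with supremum $x$. A subset $U\subseteq D$ is Scott open if it is an upper set and whenever $\bigsqcup S\in U$ with $S$ directed, some $s\in S$ is in $U$. Two points of $D$ are Hausdorff separated if they have disjoint Scott open neighbourhoods. An element $x$ of a continuous dcpo $D$ is strongly maximal if for every $u,v\in D$ with $u\ll v$, we have $u\ll x$, or $v$ and $x$ are Hausdorff separated. $(A^*,\preceq)$ is the poset of finite sequences on $A$ ordered by prefix. $\mathcal A$ is its ideal completion: the set of directed lower subsets of $(A^*,\preceq)$ ordered by inclusion, with directed suprema given by unions; it is an algebraic (hence continuous) dcpo. For a finite sequence $\sigma$ and an infinite sequence $\alpha\in A^{\mathbb N}$, $\sigma\prec\alpha$ means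 that $\sigma$ is an initial segment of $\alpha$. -}

module Defs where

open import Data.List using (List; []; _∷_; applyUpTo)
open import Data.List.Properties using (∷-injectiveˡ; ∷-injectiveʳ)
open import Data.List.Relation.Binary.Prefix.Heterogeneous using (Prefix; []; _∷_)
import Data.List.Relation.Binary.Prefix.Homogeneous.Properties as Prefix
open import Data.Nat using (ℕ; zero; suc; _≤_; z≤n; s≤s; _⊔_)
open import Data.Nat.Properties using (m≤m⊔n; m≤n⊔m)
open import Data.Product using (∃; ∃₂; _×_; _,_; proj₁; proj₂)
open import Data.Sum using (_⊎_)
open import Function.Base using (_∘_)
open import Function.Bundles using (Injection)
open import Level using (Level) renaming (suc to lsuc; _⊔_ to _⊔ˡ_)
open import Relation.Binary.Bundles using (Poset; Setoid)
open import Relation.Binary.PropositionalEquality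
  using (_≡_; _≗_; refl; sym; trans; cong₂; _→-setoid_)
import Relation.Binary.PropositionalEquality.Properties as ≡
open import Relation.Unary using (Pred; _⊆_; _≐_; _⊥_)

-- Subsets of a poset whose directedness or supremum is at issue are given as
-- families: a subset S is the family proj₁ : ∃ S → Carrier.

module _ {c ℓ₁ ℓ₂ : Level} (P : Poset c ℓ₁ ℓ₂) where
  open Poset P using (Carrier) renaming (_≤_ to _⊑_)

  IsDirected : {i : Level} {I : Set i} → (I → Carrier) → Set (ℓ₂ ⊔ˡ i)
  IsDirected {I = I} f = I × (∀ i j → ∃ λ k → f i ⊑ f k × f j ⊑ f k)

  IsSupremum : {i : Level} {I : Set i} → (I → Carrier) → Carrier → Set (c ⊔ˡ ℓ₂ ⊔ˡ i)
  IsSupremum f x = (∀ i → f i ⊑ x) × (∀ y → (∀ i → f i ⊑ y) → x ⊑ y)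

-- Directed subsets are indexed by types in a fixed universe Set i.  Asking for
-- suprema of subsets in the universe of the carrier itself would, without
-- impredicativity, rule out ideal completions.

record Dcpo (c ℓ₁ ℓ₂ i : Level) : Set (lsuc (c ⊔ˡ ℓ₁ ⊔ˡ ℓ₂ ⊔ˡ i)) where
  field
    poset : Poset c ℓ₁ ℓ₂

  open Poset poset public using (Carrier; _≈_) renaming (_≤_ to _⊑_)

  field
    ⨆     : {I : Set i} (f : I → Carrier) → IsDirected poset f → Carrier
    ⨆-sup : {I : Set i} (f : I → Carrier) (d : IsDirected poset f) →
            IsSupremum poset f (⨆ f d)

  infix 4 _≪_
  _≪_ : Carrier → Carrier → Set (c ⊔ˡ ℓ₂ ⊔ˡ lsuc i)
  x ≪ y = {I : Set i} (f : I → Carrier) (d : IsDirected poset f) →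
          y ⊑ ⨆ f d → ∃ λ s → x ⊑ f s

  ↡ : (x : Carrier) → (∃ λ y → y ≪ x) → Carrier
  ↡ x = proj₁

  IsContinuous : Set (c ⊔ˡ ℓ₂ ⊔ˡ lsuc i)
  IsContinuous = ∀ x → IsDirected poset (↡ x) × IsSupremum poset (↡ x) x

  record IsScottOpen (U : Pred Carrier i) : Set (c ⊔ˡ ℓ₂ ⊔ˡ lsuc i) where
    field
      upper        : ∀ {x y} → x ⊑ y → U x → U y
      inaccessible : {I : Set i} (f : I → Carrier) (d : IsDirected poset f) →
                     U (⨆ f d) → ∃ λ s → U (f s)

  HausdorffSeparated : Carrier → Carrier → Set (c ⊔ˡ ℓ₂ ⊔ˡ lsuc i)
  HausdorffSeparated x y = ∃₂ λ (U V : Pred Carrier i) →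
    IsScottOpen U × IsScottOpen V × U x × V y × U ⊥ V

record ContinuousDcpo (c ℓ₁ ℓ₂ i : Level) : Set (lsuc (c ⊔ˡ ℓ₁ ⊔ˡ ℓ₂ ⊔ˡ i)) where
  field
    dcpo         : Dcpo c ℓ₁ ℓ₂ i
    isContinuous : Dcpo.IsContinuous dcpo

  open Dcpo dcpo public

module _ {c ℓ₁ ℓ₂ i : Level} (D : ContinuousDcpo c ℓ₁ ℓ₂ i) where
  open ContinuousDcpo D

  StronglyMaximal : Pred Carrier (c ⊔ˡ ℓ₂ ⊔ˡ lsuc i)
  StronglyMaximal x = ∀ u v → u ≪ v → u ≪ x ⊎ HausdorffSeparated v x

module IdealCompletion {ℓ : Level} (P : Poset ℓ ℓ ℓ) where
  private module P = Poset P

  record Ideal : Set (lsuc ℓ) where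
    field
      member   : Pred P.Carrier ℓ
      lower    : ∀ {p q} → p P.≤ q → member q → member p
      directed : IsDirected P {I = ∃ member} proj₁

  open Ideal public

  idealPoset : Poset (lsuc ℓ) ℓ ℓ
  idealPoset = record
    { Carrier = Ideal
    ; _≈_     = λ x y → member x ≐ member y
    ; _≤_     = λ x y → member x ⊆ member y
    ; isPartialOrder = record
      { isPreorder = record
        { isEquivalence = record
          { refl  = (λ p → p) , (λ p → p)
          ; sym   = λ (f , g) → g , f
          ; trans = λ (f , g) (h , k) → (λ p → h (f p)) , (λ p → g (k p))
          }
        ; reflexive = proj₁
        ; trans     = λ f g p → g (f p)
        }
      ; antisym = λ f g → f , g
      }
    }

  ⋃ : {I : Set ℓ} (f : I → Ideal) → IsDirected idealPoset f → Ideal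
  ⋃ f (i₀ , up) = record
    { member   = λ p → ∃ λ i → member (f i) p
    ; lower    = λ p≤q (i , q∈) → i , lower (f i) p≤q q∈
    ; directed =
        (let ((p , p∈) , _) = directed (f i₀) in p , i₀ , p∈)
      , λ (p , i , p∈) (q , j , q∈) →
          let (k , fi⊆fk , fj⊆fk)    = up i j
              ((r , r∈) , p≤r , q≤r) =
                proj₂ (directed (f k)) (p , fi⊆fk p∈) (q , fj⊆fk q∈)
          in (r , k , r∈) , p≤r , q≤r
    }

  idealDcpo : Dcpo (lsuc ℓ) ℓ ℓ ℓ
  idealDcpo = record
    { poset = idealPoset
    ; ⨆     = ⋃
    ; ⨆-sup = λ f d → (λ i p∈ → i , p∈) , λ y f⊆y (i , p∈) → f⊆y i p∈
    }

  open Dcpo idealDcpo using (_⊑_; _≪_; IsContinuous)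

  principal : P.Carrier → Ideal
  principal p = record
    { member   = P._≤ p
    ; lower    = P.trans
    ; directed = (p , P.refl) , λ (_ , q≤p) (_ , r≤p) → (p , P.refl) , q≤p , r≤p
    }

  principal-⊑ : ∀ (x : Ideal) {p} → member x p → principal p ⊑ x
  principal-⊑ x p∈ q≤p = lower x q≤p p∈

  principal-≪ : ∀ (x : Ideal) {p} → member x p → principal p ≪ x
  principal-≪ x p∈ f d x⊑ = let (i , p∈fi) = x⊑ p∈ in i , principal-⊑ (f i) p∈fi

  principals : (x : Ideal) → ∃ (member x) → Ideal
  principals x (p , _) = principal p

  principals-directed : ∀ x → IsDirected idealPoset (principals x)
  principals-directed x = proj₁ (directed x) , λ i j →
    let (k , p≤r , q≤r) = proj₂ (directed x) i j
    in k , (λ s≤p → P.trans s≤p p≤r) , (λ s≤q → P.trans s≤q q≤r)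

  ≪⇒⊑principal : ∀ {x y} → y ≪ x → ∃ λ (s : ∃ (member x)) → y ⊑ principals x s
  ≪⇒⊑principal {x} y≪x =
    y≪x (principals x) (principals-directed x) (λ {p} p∈ → (p , p∈) , P.refl)

  idealContinuous : IsContinuous
  idealContinuous x =
      ( (let ((p , p∈) , _) = directed x in principal p , principal-≪ x p∈)
      , λ (y , y≪x) (z , z≪x) →
          let (s , y⊑s)            = ≪⇒⊑principal {x} {y} y≪x
              (t , z⊑t)            = ≪⇒⊑principal {x} {z} z≪x
              ((r , r∈) , s≤r , t≤r) = proj₂ (directed x) s t
          in (principal r , principal-≪ x r∈)
           , (λ q∈ → P.trans (y⊑s q∈) s≤r) , (λ q∈ → P.trans (z⊑t q∈) t≤r) )
    , ( (λ (y , y≪x) q∈ →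
          let ((p , p∈) , y⊑p) = ≪⇒⊑principal {x} {y} y≪x in lower x (y⊑p q∈) p∈)
      , λ b bound {p} p∈ → bound (principal p , principal-≪ x p∈) P.refl )

  Idl : ContinuousDcpo (lsuc ℓ) ℓ ℓ ℓ
  Idl = record { dcpo = idealDcpo ; isContinuous = idealContinuous }

Image : {a b ℓ₁ ℓ₂ : Level} {S : Setoid a ℓ₁} {T : Setoid b ℓ₂} →
        Injection S T → Pred (Setoid.Carrier T) (a ⊔ˡ ℓ₂)
Image {T = T} f y = ∃ λ x → Setoid._≈_ T (Injection.to f x) y

module _ {ℓ : Level} (A : Set ℓ) where

  prefixPoset : Poset ℓ ℓ ℓ
  prefixPoset = record
    { isPartialOrder = Prefix.isPartialOrder (≡.isPartialOrder {A = A}) }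

  open IdealCompletion prefixPoset

  𝒜 : ContinuousDcpo (lsuc ℓ) ℓ ℓ ℓ
  𝒜 = Idl

  infix 4 _≺_
  _≺_ : List A → (ℕ → A) → Set ℓ
  σ ≺ α = ∃ λ n → σ ≡ applyUpTo α n

  applyUpTo-mono : ∀ (α : ℕ → A) {m n} → m ≤ n →
                   Prefix _≡_ (applyUpTo α m) (applyUpTo α n)
  applyUpTo-mono α z≤n       = []
  applyUpTo-mono α (s≤s m≤n) = refl ∷ applyUpTo-mono (α ∘ suc) m≤n

  ≺-lower : ∀ α {σ τ} → Prefix _≡_ σ τ → τ ≺ α → σ ≺ α
  ≺-lower α []           _              = zero , refl
  ≺-lower α (refl ∷ σ≤τ) (suc n , aτ≡) =
    let (m , σ≡) = ≺-lower (α ∘ suc) σ≤τ (n , ∷-injectiveʳ aτ≡)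
    in suc m , cong₂ _∷_ (∷-injectiveˡ aτ≡) σ≡

  applyUpTo-cong : ∀ {α β : ℕ → A} → α ≗ β → ∀ n → applyUpTo α n ≡ applyUpTo β n
  applyUpTo-cong α≗β zero    = refl
  applyUpTo-cong α≗β (suc n) = cong₂ _∷_ (α≗β 0) (applyUpTo-cong (α≗β ∘ suc) n)

  applyUpTo-injective : ∀ (α β : ℕ → A) n {m} →
                        applyUpTo α (suc n) ≡ applyUpTo β m → α n ≡ β n
  applyUpTo-injective α β zero    {suc m} eq = ∷-injectiveˡ eq
  applyUpTo-injective α β (suc n) {suc m} eq =
    applyUpTo-injective (α ∘ suc) (β ∘ suc) n (∷-injectiveʳ eq)

  initialSegments : (ℕ → A) → Ideal
  initialSegments α = record
    { member   = _≺ α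
    ; lower    = ≺-lower α
    ; directed = ([] , zero , refl) , λ { (_ , m , refl) (_ , n , refl) →
        (applyUpTo α (m ⊔ n) , m ⊔ n , refl)
      , applyUpTo-mono α (m≤m⊔n m n) , applyUpTo-mono α (m≤n⊔m m n) }
    }

  ι : Injection (ℕ →-setoid A) (Poset.Eq.setoid (ContinuousDcpo.poset 𝒜))
  ι = record
    { to        = initialSegments
    ; cong      = λ α≗β →
        (λ (n , eq) → n , trans eq (applyUpTo-cong α≗β n))
      , (λ (n , eq) → n , trans eq (sym (applyUpTo-cong α≗β n)))
    ; injective = λ {α} {β} (ια⊆ιβ , _) n →
        let (_ , eq) = ια⊆ιβ (suc n , refl) in applyUpTo-injective α β n eq
    }

{-# OPTIONS --safe #-}

-- Ideals are controlled by the finite sequences they contain: u ≪ v holds iff u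
-- lies below some σ ∈ v, and a Scott open set containing x contains the principal
-- ideal of some τ ∈ x.  If x is the ideal of α, equality of σ with the segment of α
-- of the same length is decidable; when they differ, σ and that segment have no
-- common extension, so they separate v from x.  Conversely, let x be strongly
-- maximal, σ ∈ x and a ∈ A.  Either σa ∈ x, or disjoint Scott open sets separate
-- ↓(σa) from x.  In the latter case some τ ∈ x generates an ideal in the second open
-- set; a common extension of σ and τ in x cannot be σ itself, as then ↓(σa) would lie
-- in both open sets.  So every σ ∈ x extends by one letter within x, and iterating
-- this from [] yields α.

module Submission where

open import Defs
open import Data.List using (List; []; _∷_; _∷ʳ_; applyUpTo; length)
open import Data.List.Properties using (applyUpTo-∷ʳ; length-applyUpTo; ≡-dec)
open import Data.List.Relation.Binary.Prefix.Heterogeneous using (Prefix; []; _∷_)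
open import Data.Nat using (ℕ; zero; suc)
open import Data.Nat.Properties using (suc-injective)
open import Data.Product using (∃; _×_; _,_; proj₁; proj₂; map₂)
open import Data.Sum using (_⊎_; inj₁; inj₂)
open import Level using (Level)
open import Relation.Binary.Bundles using (Poset)
open import Relation.Binary.Definitions using (DecidableEquality)
open import Relation.Binary.PropositionalEquality
  using (_≡_; refl; sym; trans; cong; subst)
open import Relation.Nullary using (¬_; yes; no; contradiction)
open import Relation.Unary using (Pred; _≐_)

module _ {ℓ : Level} (P : Poset ℓ ℓ ℓ) where
  open IdealCompletion P
  open ContinuousDcpo Idl using (_⊑_; _≪_; IsScottOpen)
  private module P = Poset P

  ⊑principal⇒≪ : ∀ (u x : Ideal) {p} → member x p → u ⊑ principal p → u ≪ x
  ⊑principal⇒≪ u x p∈x u⊑p f d x⊑ =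
    map₂ (λ p⊑ {_} q∈u → p⊑ (u⊑p q∈u)) (principal-≪ x p∈x f d x⊑)

  principal-≪⇒member : ∀ (x : Ideal) {p} → principal p ≪ x → member x p
  principal-≪⇒member x {p} p≪x =
    let ((_ , s∈x) , p⊑s) = ≪⇒⊑principal {x} {principal p} p≪x
    in lower x (p⊑s P.refl) s∈x

  -- Directed suprema are unions, so `p` lies in one only by lying in some ideal of the family.
  containing-isScottOpen : ∀ p → IsScottOpen (λ x → member x p)
  containing-isScottOpen p = record
    { upper        = λ x⊑y → x⊑y
    ; inaccessible = λ _ _ p∈ → p∈
    }

  -- `x` is the directed union of the principal ideals of its members, so inaccessibility finds one
  -- of these in `V`.
  scottOpen-principal : ∀ {V : Pred Ideal ℓ} → IsScottOpen V → ∀ x → V x →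
                        ∃ λ p → member x p × V (principal p)
  scottOpen-principal V-open x x∈V =
    let ((p , p∈x) , p∈V) = inaccessible (principals x) (principals-directed x)
                              (upper {x} (λ {p} p∈x → (p , p∈x) , P.refl) x∈V)
    in p , p∈x , p∈V
    where open IsScottOpen V-open

module _ {a : Level} {A : Set a} where

  prefix-equal-length : ∀ {σ τ ρ : List A} → Prefix _≡_ σ ρ → Prefix _≡_ τ ρ →
                        length σ ≡ length τ → σ ≡ τ
  prefix-equal-length []           []           _  = refl
  prefix-equal-length (refl ∷ σ≤ρ) (refl ∷ τ≤ρ) eq =
    cong (_ ∷_) (prefix-equal-length σ≤ρ τ≤ρ (suc-injective eq))

  prefix-≡-or-snoc : ∀ {σ ρ : List A} → Prefix _≡_ σ ρ →
                     σ ≡ ρ ⊎ ∃ λ b → Prefix _≡_ (σ ∷ʳ b) ρ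
  prefix-≡-or-snoc {ρ = []}    []           = inj₁ refl
  prefix-≡-or-snoc {ρ = b ∷ _} []           = inj₂ (b , refl ∷ [])
  prefix-≡-or-snoc             (refl ∷ σ≤ρ) with prefix-≡-or-snoc σ≤ρ
  ... | inj₁ σ≡ρ        = inj₁ (cong (_ ∷_) σ≡ρ)
  ... | inj₂ (b , σb≤ρ) = inj₂ (b , refl ∷ σb≤ρ)

  prefix-snoc : ∀ (σ : List A) b → Prefix _≡_ σ (σ ∷ʳ b)
  prefix-snoc []      b = []
  prefix-snoc (_ ∷ σ) b = refl ∷ prefix-snoc σ b

module _ {ℓ : Level} (A : Set ℓ) where
  private module Seq = Poset (prefixPoset A)
  open IdealCompletion (prefixPoset A)
  open ContinuousDcpo (𝒜 A) using (HausdorffSeparated; module IsScottOpen)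

  -- By directedness both lists are prefixes of a common one, where length determines a prefix.
  ideal-equal-length : ∀ (x : Ideal) {σ τ} → member x σ → member x τ →
                       length σ ≡ length τ → σ ≡ τ
  ideal-equal-length x σ∈x τ∈x =
    let (_ , σ≤ρ , τ≤ρ) = proj₂ (directed x) (_ , σ∈x) (_ , τ∈x)
    in prefix-equal-length σ≤ρ τ≤ρ

  equal-length-separated : ∀ (x y : Ideal) {σ τ} → member x σ → member y τ →
                           length σ ≡ length τ → ¬ σ ≡ τ → HausdorffSeparated x y
  equal-length-separated x y {σ} {τ} σ∈x τ∈y |σ|≡|τ| σ≢τ =
      (λ z → member z σ) , (λ z → member z τ)
    , containing-isScottOpen (prefixPoset A) σ
    , containing-isScottOpen (prefixPoset A) τ
    , σ∈x , τ∈y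
    , λ {z} (σ∈z , τ∈z) → σ≢τ (ideal-equal-length z σ∈z τ∈z |σ|≡|τ|)

  image⇒stronglyMaximal : DecidableEquality A → ∀ {x} →
                          Image (ι A) x → StronglyMaximal (𝒜 A) x
  image⇒stronglyMaximal _≟_ {x} (α , α⊆x , _) u v u≪v
    with ≪⇒⊑principal {v} {u} u≪v
  -- `σ` can be a segment of `α` only as the one of its own length, so a single comparison of finite
  -- lists decides the case.
  ... | (σ , σ∈v) , u⊑σ with ≡-dec _≟_ σ (applyUpTo α (length σ))
  ...   | yes σ≡α = inj₁ (⊑principal⇒≪ (prefixPoset A) u x (α⊆x (_ , σ≡α)) u⊑σ)
  ...   | no  σ≢α = inj₂ (equal-length-separated v x σ∈v (α⊆x (length σ , refl))
                            (sym (length-applyUpTo α (length σ))) σ≢α)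

  stronglyMaximal-extend : A → ∀ {x} → StronglyMaximal (𝒜 A) x →
                           ∀ {σ} → member x σ → ∃ λ b → member x (σ ∷ʳ b)
  stronglyMaximal-extend a {x} x-max {σ} σ∈x
    -- A principal ideal is way below itself, so it may serve as both `u` and `v`. The letter
    -- finally returned may differ from `a`.
    with x-max (principal (σ ∷ʳ a)) (principal (σ ∷ʳ a))
               (principal-≪ (principal (σ ∷ʳ a)) Seq.refl)
  ... | inj₁ σa≪x = a , principal-≪⇒member (prefixPoset A) x σa≪x
  ... | inj₂ (U , V , _ , V-open , σa∈U , x∈V , U⊥V)
    with scottOpen-principal (prefixPoset A) V-open x x∈V
  ...   | τ , τ∈x , τ∈V with proj₂ (directed x) (σ , σ∈x) (τ , τ∈x)
  ...     | (ρ , ρ∈x) , σ≤ρ , τ≤ρ with prefix-≡-or-snoc σ≤ρ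
  ...       | inj₂ (b , σb≤ρ) = b , lower x σb≤ρ ρ∈x
  -- Now `τ` is a prefix of `σ`, hence of `σ ∷ʳ a`, and `V` is an upper set.
  ...       | inj₁ refl       = contradiction (σa∈U , σa∈V) U⊥V
    where
    σa∈V : V (principal (σ ∷ʳ a))
    σa∈V = IsScottOpen.upper V-open
      (λ q≤τ → Seq.trans q≤τ (Seq.trans τ≤ρ (prefix-snoc σ a))) τ∈V

  module _ (x : Ideal) (extend : ∀ {σ} → member x σ → ∃ λ b → member x (σ ∷ʳ b)) where

    -- Membership is carried along because `extend` consumes it to produce the next letter.
    segment : ℕ → ∃ (member x)
    segment zero    = [] , lower x [] (proj₂ (proj₁ (directed x)))
    segment (suc n) = let (σ , σ∈x)  = segment n
                          (b , σb∈x) = extend σ∈x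
                      in σ ∷ʳ b , σb∈x

    branch : ℕ → A
    branch n = proj₁ (extend (proj₂ (segment n)))

    segment≡applyUpTo : ∀ n → proj₁ (segment n) ≡ applyUpTo branch n
    segment≡applyUpTo zero    = refl
    segment≡applyUpTo (suc n) =
      trans (cong (_∷ʳ branch n) (segment≡applyUpTo n)) (applyUpTo-∷ʳ branch n)

    applyUpTo-branch-member : ∀ n → member x (applyUpTo branch n)
    applyUpTo-branch-member n =
      subst (member x) (segment≡applyUpTo n) (proj₂ (segment n))

    extendable⇒image : Image (ι A) x
    extendable⇒image = branch
      , (λ { (n , refl) → applyUpTo-branch-member n })
      -- `x` also contains the segment of `branch` as long as `σ`, and an ideal has at most one
      -- member of each length.
      , λ {σ} σ∈x → length σ ,
          ideal-equal-length x σ∈x (applyUpTo-branch-member (length σ))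
            (sym (length-applyUpTo branch (length σ)))

theorem7p4 : {ℓ : Level} (A : Set ℓ) → A → DecidableEquality A →
    Image (ι A) ≐ StronglyMaximal (𝒜 A)
theorem7p4 A a _≟_ =
    (λ {x} → image⇒stronglyMaximal A _≟_ {x})
  , λ {x} x-max → extendable⇒image A x (stronglyMaximal-extend A a {x} x-max)
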